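{- For every $n\ge 1$, $$\sum_{\sigma\in B_n} \mathrm{sign}(|\sigma|)\, q^{\mathrm{fmaj}(\sigma)} = [2]_{q}[4]_{ -q}\cdots[2n]_{(-1)^{n-1}q}.$$
   Context: $B_n$ is the group of signed permutations of $[n]$. For $\sigma\in B_n$, $\mathrm{sign}(|\sigma|)$ is the sign of the permutation $(|\sigma(1)|,\dots,|\sigma(n)|)\in S_n$. $[n]_q=(1-q^n)/(1-q)$. $\mathrm{neg}(\sigma)=\#\{i:\sigma(i)<0\}$; $\mathrm{fmaj}(\sigma)=2\,\mathrm{maj}(\sigma)+\mathrm{neg}(\sigma)$ with $\mathrm{maj}$ the major index of $(\sigma(1),\dots,\sigma(n))$ with respect to the order $-1<\cdots<-n<1<\cdots<n$. -}

module Defs where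

open import Data.Bool using (Bool; true; false; if_then_else_; _∧_; not)
open import Data.Nat using (ℕ; zero; suc; _<ᵇ_; _≡ᵇ_)
import Data.Nat as N
open import Data.Nat.Properties using ()
open import Data.Fin using (Fin; toℕ)
open import Data.Product using (_×_; _,_; proj₁; proj₂)
open import Data.List using (List; []; _∷_; map; concatMap; allFin; filterᵇ; length; upTo)
open import Algebra.Bundles using (CommutativeRing)

-- A letter of a signed word: (b , i) stands for the signed integer
-- -(toℕ i + 1) if b = true and +(toℕ i + 1) if b = false.
Letter : ℕ → Set
Letter n = Bool × Fin n

letters : (n : ℕ) → List (Letter n)
letters n = concatMap (λ b → map (λ i → (b , i)) (allFin n)) (true ∷ false ∷ [])

words : {A : Set} → List A → ℕ → List (List A)
words xs zero = [] ∷ []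
words xs (suc k) = concatMap (λ x → map (x ∷_) (words xs k)) xs

absℕ : {n : ℕ} → Letter n → ℕ
absℕ (_ , i) = toℕ i

notIn : ℕ → List ℕ → Bool
notIn a [] = true
notIn a (b ∷ bs) = not (a ≡ᵇ b) ∧ notIn a bs

distinct : List ℕ → Bool
distinct [] = true
distinct (a ∷ as) = notIn a as ∧ distinct as

-- B_n : the signed permutations of [n], as the words (σ(1),…,σ(n)) of
-- length n over {±1,…,±n} whose absolute values are pairwise distinct
-- (equivalently, (|σ(1)|,…,|σ(n)|) is a permutation of [n]).
Bn : (n : ℕ) → List (List (Letter n))
Bn n = filterᵇ (λ w → distinct (map absℕ w)) (words (letters n) n)

inv : {n : ℕ} → List (Letter n) → ℕ
inv [] = 0
inv (x ∷ xs) = length (filterᵇ (λ y → absℕ y <ᵇ absℕ x) xs) N.+ inv xs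

neg : {n : ℕ} → List (Letter n) → ℕ
neg [] = 0
neg ((true , _) ∷ xs) = suc (neg xs)
neg ((false , _) ∷ xs) = neg xs

-- rank in the total order -1 < -2 < … < -n < 1 < 2 < … < n
key : {n : ℕ} → Letter n → ℕ
key {n} (true , i) = toℕ i
key {n} (false , i) = n N.+ toℕ i

majFrom : {n : ℕ} → ℕ → List (Letter n) → ℕ
majFrom pos [] = 0
majFrom pos (x ∷ []) = 0
majFrom pos (x ∷ y ∷ rest) =
  (if key y <ᵇ key x then pos else 0) N.+ majFrom (suc pos) (y ∷ rest)

maj : {n : ℕ} → List (Letter n) → ℕ
maj = majFrom 1

fmaj : {n : ℕ} → List (Letter n) → ℕ
fmaj w = 2 N.* maj w N.+ neg w

even : ℕ → Bool
even zero = true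
even (suc k) = not (even k)

module RingDefs {c ℓ} (R : CommutativeRing c ℓ) where
  open CommutativeRing R

  pow : Carrier → ℕ → Carrier
  pow x zero = 1#
  pow x (suc k) = x * pow x k

  sumL : List Carrier → Carrier
  sumL [] = 0#
  sumL (x ∷ xs) = x + sumL xs

  prodL : List Carrier → Carrier
  prodL [] = 1#
  prodL (x ∷ xs) = x * prodL xs

  signAbs : {n : ℕ} → List (Letter n) → Carrier
  signAbs w = if even (inv w) then 1# else - 1#

  qint : ℕ → Carrier → Carrier
  qint m x = sumL (map (pow x) (upTo m))

  altq : ℕ → Carrier → Carrier
  altq k q = if even k then - q else q

  LHS : ℕ → Carrier → Carrier
  LHS n q = sumL (map (λ σ → signAbs σ * pow q (fmaj σ)) (Bn n))

  RHS : ℕ → Carrier → Carrier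
  RHS n q = prodL (map (λ j → qint (2 N.* suc j) (altq (suc j) q)) (upTo n))

{-# OPTIONS --safe #-}
module Submission where

-- Rotating the alphabet cyclically, -1 → n → … → 1 → -n → … → -2 → -1, lowers `key` by 1
-- modulo 2n. Applied to a signed permutation whose last letter is not -1 it raises fmaj
-- by exactly 1, because only the descents next to the letter ±1 can change; it multiplies
-- sign |σ| by the sign (-1)ⁿ⁻¹ of an n-cycle. Each orbit consists of 2n words with
-- distinct last letters, starting with one that ends in n, and deleting that n identifies
-- the starting words with B_(n-1). Hence the sum for B_n is [2n] at (-1)ⁿ⁻¹q times the sum for B_(n-1).

open import Defs
open import Algebra.Bundles using (CommutativeRing)
import Algebra.Properties.Ring as RingProperties
import Algebra.Solver.Ring.NaturalCoefficients.Default as SemiringSolver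
open import Data.Bool using (Bool; true; false; if_then_else_; _∧_; not)
open import Data.Bool.Properties using (∧-zeroʳ)
open import Data.Empty using (⊥-elim)
open import Data.Fin using (Fin; zero; suc; toℕ; fromℕ; inject₁)
open import Data.Fin.Properties using (toℕ-fromℕ; toℕ-inject₁; toℕ<n)
open import Data.List using (List; []; _∷_; _++_; _∷ʳ_; allFin; map; concatMap; filterᵇ; length; tabulate; upTo; applyUpTo)
open import Data.List.Properties using (++-assoc; length-++; length-++-sucʳ; length-map; map-++; map-tabulate; map-upTo; map-∘; upTo-∷ʳ; ∷ʳ-injectiveʳ)
open import Data.List.Relation.Unary.All using (All; []; _∷_)
import Data.List.Relation.Unary.All as All
import Data.List.Relation.Unary.All.Properties as All
open import Data.Nat using (ℕ; zero; suc; _≤_; _<_; z≤n; s≤s; _<ᵇ_; _≡ᵇ_)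
import Data.Nat as ℕ
import Data.Nat.Properties as ℕ
open import Data.Nat.Tactic.RingSolver using (solve-∀)
open import Data.Product using (_×_; _,_; ∃)
open import Function using (_∘_)
open import Relation.Binary.PropositionalEquality as ≡ using (_≡_; _≢_; cong; cong₂; subst)
import Relation.Binary.Reasoning.Setoid as SetoidReasoning

-- Boolean comparison of natural numbers.

<ᵇ-true : ∀ {m n} → m < n → (m <ᵇ n) ≡ true
<ᵇ-true {zero}  (s≤s _)         = ≡.refl
<ᵇ-true {suc m} (s≤s m<n@(s≤s _)) = <ᵇ-true m<n

<ᵇ-false : ∀ {m n} → n ≤ m → (m <ᵇ n) ≡ false
<ᵇ-false {m}     z≤n       = ≡.refl
<ᵇ-false {suc m} (s≤s n≤m) = <ᵇ-false n≤m

≡ᵇ-refl : ∀ n → (n ≡ᵇ n) ≡ true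
≡ᵇ-refl zero    = ≡.refl
≡ᵇ-refl (suc n) = ≡ᵇ-refl n

≡ᵇ-sym : ∀ m n → (m ≡ᵇ n) ≡ (n ≡ᵇ m)
≡ᵇ-sym zero    zero    = ≡.refl
≡ᵇ-sym zero    (suc n) = ≡.refl
≡ᵇ-sym (suc m) zero    = ≡.refl
≡ᵇ-sym (suc m) (suc n) = ≡ᵇ-sym m n

<⇒≡ᵇ-false : ∀ {m n} → m < n → (m ≡ᵇ n) ≡ false
<⇒≡ᵇ-false {zero}  (s≤s _)         = ≡.refl
<⇒≡ᵇ-false {suc m} (s≤s m<n@(s≤s _)) = <⇒≡ᵇ-false m<n

∧-true⁻ : ∀ {x y} → x ∧ y ≡ true → x ≡ true × y ≡ true
∧-true⁻ {true} {true} _ = ≡.refl , ≡.refl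

∧-true⁺ : ∀ {x y} → x ≡ true → y ≡ true → x ∧ y ≡ true
∧-true⁺ ≡.refl ≡.refl = ≡.refl

-- Distinctness

module _ {A : Set} {f g : A → ℕ} (f≡ᵇg : ∀ x y → (f x ≡ᵇ f y) ≡ (g x ≡ᵇ g y)) where

  notIn-map-cong : ∀ x xs → notIn (f x) (map f xs) ≡ notIn (g x) (map g xs)
  notIn-map-cong x []       = ≡.refl
  notIn-map-cong x (y ∷ ys) = cong₂ (λ b c → not b ∧ c) (f≡ᵇg x y) (notIn-map-cong x ys)

  -- `distinct` looks at its entries only through equality tests. This lets `ρ`, `lift` and `emb`
  -- act on words although they may change absolute values.
  distinct-map-cong : ∀ xs → distinct (map f xs) ≡ distinct (map g xs)
  distinct-map-cong []       = ≡.refl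
  distinct-map-cong (x ∷ xs) = cong₂ _∧_ (notIn-map-cong x xs) (distinct-map-cong xs)

notIn-remove : ∀ a xs {c ys} → notIn a (xs ++ c ∷ ys) ≡ true → notIn a (xs ++ ys) ≡ true
notIn-remove a []       p = let _ , q = ∧-true⁻ p in q
notIn-remove a (x ∷ xs) p = let q , r = ∧-true⁻ p in ∧-true⁺ q (notIn-remove a xs r)

distinct-remove : ∀ xs {c ys} → distinct (xs ++ c ∷ ys) ≡ true → distinct (xs ++ ys) ≡ true
distinct-remove []       p = let _ , q = ∧-true⁻ p in q
distinct-remove (x ∷ xs) p =
  let q , r = ∧-true⁻ p in ∧-true⁺ (notIn-remove x xs q) (distinct-remove xs r)

notIn-∈ : ∀ c xs ys → notIn c (xs ++ c ∷ ys) ≡ false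
notIn-∈ c []       ys rewrite ≡ᵇ-refl c = ≡.refl
notIn-∈ c (x ∷ xs) ys rewrite notIn-∈ c xs ys = ∧-zeroʳ _

distinct-repeat : ∀ c xs ys zs → distinct (xs ++ c ∷ ys ++ c ∷ zs) ≡ false
distinct-repeat c []       ys zs rewrite notIn-∈ c ys zs = ≡.refl
distinct-repeat c (x ∷ xs) ys zs rewrite distinct-repeat c xs ys zs = ∧-zeroʳ _

notIn-∷ʳ : ∀ {a c} xs → (a ≡ᵇ c) ≡ false → notIn a (xs ∷ʳ c) ≡ notIn a xs
notIn-∷ʳ []       a≢c rewrite a≢c = ≡.refl
notIn-∷ʳ (x ∷ xs) a≢c = cong (_ ∧_) (notIn-∷ʳ xs a≢c)

distinct-∷ʳ : ∀ {c xs} → All (λ a → (a ≡ᵇ c) ≡ false) xs → distinct (xs ∷ʳ c) ≡ distinct xs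
distinct-∷ʳ []               = ≡.refl
distinct-∷ʳ {xs = x ∷ xs} (x≢c ∷ xs≢c) = cong₂ _∧_ (notIn-∷ʳ xs x≢c) (distinct-∷ʳ xs≢c)

-- Rotating the alphabet

lift : ∀ {m} → Letter m → Letter (suc m)
lift (s , i) = s , suc i

-- `lift` reaches every letter except 1 and -1, `emb` every letter except those of largest absolute
-- value. `ρ (lift x)` reduces to `emb x`.
emb : ∀ {m} → Letter m → Letter (suc m)
emb (s , i) = s , inject₁ i

top : ∀ {m} → Letter (suc m)
top {m} = false , fromℕ m

bottom : ∀ {m} → Letter (suc m)
bottom = true , zero

-- The cyclic rotation lowering `key` by 1 modulo 2 (suc m).
ρ : ∀ {m} → Letter (suc m) → Letter (suc m)
ρ     (s , suc i) = s , inject₁ i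
ρ {m} (s , zero)  = not s , fromℕ m

absℕ-emb : ∀ {m} (x : Letter m) → absℕ (emb x) ≡ absℕ x
absℕ-emb (_ , i) = toℕ-inject₁ i

absℕ< : ∀ {m} (x : Letter m) → absℕ x < m
absℕ< (_ , i) = toℕ<n i

key-lift : ∀ {m} (x : Letter m) → key (lift x) ≡ suc (key (emb x))
key-lift     (true  , i) = cong suc (≡.sym (toℕ-inject₁ i))
key-lift {m} (false , i) =
  ≡.trans (ℕ.+-suc (suc m) (toℕ i)) (cong (λ k → suc (suc m ℕ.+ k)) (≡.sym (toℕ-inject₁ i)))

-- In this order 1 comes directly after -n, so the change of sign at 1 is a step down by one like
-- all others. Only -1, of key 0, wraps around.
key-ρ : ∀ {m} (x : Letter (suc m)) → x ≢ bottom → key x ≡ suc (key (ρ x))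
key-ρ     (s     , suc i) _ = key-lift (s , i)
key-ρ     (true  , zero)  x≢bottom = ⊥-elim (x≢bottom ≡.refl)
key-ρ {m} (false , zero)  _ = cong suc (≡.trans (ℕ.+-identityʳ m) (≡.sym (toℕ-fromℕ m)))

key-emb<top : ∀ {m} (x : Letter m) → key (emb x) < key (top {m})
key-emb<top {m} (true , i)  rewrite toℕ-inject₁ i = s≤s (ℕ.≤-trans (ℕ.<⇒≤ (toℕ<n i)) (ℕ.m≤m+n m _))
key-emb<top {m} (false , i) rewrite toℕ-inject₁ i | toℕ-fromℕ m = ℕ.+-monoʳ-< (suc m) (toℕ<n i)

-- On absolute values `ρ` is a cyclic shift, hence injective.
ρ-≡ᵇ : ∀ {m} (x y : Letter (suc m)) → (absℕ (ρ x) ≡ᵇ absℕ (ρ y)) ≡ (absℕ x ≡ᵇ absℕ y)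
ρ-≡ᵇ (_ , suc i) (_ , suc j) rewrite toℕ-inject₁ i | toℕ-inject₁ j = ≡.refl
ρ-≡ᵇ {m} (_ , suc i) (_ , zero) rewrite toℕ-inject₁ i | toℕ-fromℕ m = <⇒≡ᵇ-false (toℕ<n i)
ρ-≡ᵇ {m} (_ , zero) (_ , suc j) rewrite toℕ-inject₁ j | toℕ-fromℕ m =
  ≡.trans (≡ᵇ-sym m (toℕ j)) (<⇒≡ᵇ-false (toℕ<n j))
ρ-≡ᵇ {m} (_ , zero) (_ , zero) = ≡ᵇ-refl (toℕ (fromℕ m))

-- Locating the letter of absolute value 1.

distinctAbs : ∀ {n} → List (Letter n) → Bool
distinctAbs w = distinct (map absℕ w)

distinctAbs-map : ∀ {n n′} (f : Letter n → Letter n′) →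
                  (∀ x y → (absℕ (f x) ≡ᵇ absℕ (f y)) ≡ (absℕ x ≡ᵇ absℕ y)) →
                  ∀ w → distinctAbs (map f w) ≡ distinctAbs w
distinctAbs-map f f-≡ᵇ w = ≡.trans (cong distinct (≡.sym (map-∘ w))) (distinct-map-cong f-≡ᵇ w)

-- Under `ρ` all letters other than 1 and -1 pass from `lift` to `emb` and keep their mutual order,
-- so the effect on each statistic depends on where the exceptional letter stands. The case `none`
-- is later excluded for words of full length by counting.
data Decomposition {m} : List (Letter (suc m)) → Set where
  none : ∀ a → Decomposition (map lift a)
  one  : ∀ a s b → Decomposition (map lift a ++ (s , zero) ∷ map lift b)

notIn-zero⇒lift : ∀ {m} (w : List (Letter (suc m))) → notIn 0 (map absℕ w) ≡ true → ∃ λ a → w ≡ map lift a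
notIn-zero⇒lift []              _ = [] , ≡.refl
notIn-zero⇒lift ((s , suc i) ∷ w) p with notIn-zero⇒lift w p
... | a , ≡.refl = (s , i) ∷ a , ≡.refl

decompose : ∀ {m} (w : List (Letter (suc m))) → distinctAbs w ≡ true → Decomposition w
decompose []                _ = none []
decompose ((s , zero) ∷ w)  p with notIn-zero⇒lift w (let q , _ = ∧-true⁻ p in q)
... | b , ≡.refl = one [] s b
decompose ((s , suc i) ∷ w) p with decompose w (let _ , q = ∧-true⁻ {notIn (suc (toℕ i)) (map absℕ w)} p in q)
... | none a     = none ((s , i) ∷ a)
... | one a s′ b = one ((s , i) ∷ a) s′ b

-- Pigeonhole by induction on the alphabet: remove the letter of absolute value 1, if present, and
-- lower the others.
distinct⇒length≤ : ∀ {m} (w : List (Letter m)) → distinctAbs w ≡ true → length w ≤ m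
distinct⇒length≤ {zero}  []            _ = z≤n
distinct⇒length≤ {zero}  ((_ , ()) ∷ _)
distinct⇒length≤ {suc m} w p with decompose w p
... | none a = ℕ.m≤n⇒m≤1+n (subst (_≤ m) (≡.sym (length-map lift a))
    (distinct⇒length≤ a (≡.trans (≡.sym (distinctAbs-map lift (λ _ _ → ≡.refl) a)) p)))
... | one a s b = subst (_≤ suc m) (≡.sym eq) (s≤s (distinct⇒length≤ (a ++ b) distinct-ab))
  where
  open ≡.≡-Reasoning
  eq : length (map lift a ++ (s , zero) ∷ map lift b) ≡ suc (length (a ++ b))
  eq = begin
    length (map lift a ++ (s , zero) ∷ map lift b) ≡⟨ length-++-sucʳ (map lift a) _ _ ⟩
    suc (length (map lift a ++ map lift b))        ≡⟨ cong (suc ∘ length) (map-++ lift a b) ⟨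
    suc (length (map lift (a ++ b)))               ≡⟨ cong suc (length-map lift (a ++ b)) ⟩
    suc (length (a ++ b))                          ∎
  distinct-ab : distinctAbs (a ++ b) ≡ true
  distinct-ab = begin
    distinctAbs (a ++ b)                                     ≡⟨ distinctAbs-map lift (λ _ _ → ≡.refl) (a ++ b) ⟨
    distinct (map absℕ (map lift (a ++ b)))                  ≡⟨ cong (distinct ∘ map absℕ) (map-++ lift a b) ⟩
    distinct (map absℕ (map lift a ++ map lift b))           ≡⟨ cong distinct (map-++ absℕ (map lift a) _) ⟩
    distinct (map absℕ (map lift a) ++ map absℕ (map lift b))
      ≡⟨ distinct-remove (map absℕ (map lift a)) (≡.trans (cong distinct (≡.sym (map-++ absℕ (map lift a) _))) p) ⟩
    true ∎

-- Statistics under rotation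

map-ρ-decomposition : ∀ {m} (a : List (Letter m)) s b →
  map ρ (map lift a ++ (s , zero) ∷ map lift b) ≡ map emb a ++ (not s , fromℕ m) ∷ map emb b
map-ρ-decomposition []      s b = cong (_ ∷_) (≡.sym (map-∘ b))
map-ρ-decomposition (x ∷ a) s b = cong (emb x ∷_) (map-ρ-decomposition a s b)

smaller : ∀ {n} → Letter n → List (Letter n) → ℕ
smaller x w = length (filterᵇ (λ y → absℕ y <ᵇ absℕ x) w)

module _ {n n′} (f : Letter n → Letter n′)
         (f-<ᵇ : ∀ x y → (absℕ (f y) <ᵇ absℕ (f x)) ≡ (absℕ y <ᵇ absℕ x)) where

  smaller-map : ∀ x w → smaller (f x) (map f w) ≡ smaller x w
  smaller-map x []      = ≡.refl
  smaller-map x (y ∷ w) rewrite f-<ᵇ x y with absℕ y <ᵇ absℕ x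
  ... | true  = cong suc (smaller-map x w)
  ... | false = smaller-map x w

  inv-map : ∀ w → inv (map f w) ≡ inv w
  inv-map []      = ≡.refl
  inv-map (x ∷ w) = cong₂ ℕ._+_ (smaller-map x w) (inv-map w)

emb-<ᵇ : ∀ {m} (x y : Letter m) → (absℕ (emb y) <ᵇ absℕ (emb x)) ≡ (absℕ y <ᵇ absℕ x)
emb-<ᵇ x y = cong₂ _<ᵇ_ (absℕ-emb y) (absℕ-emb x)

smaller-zero : ∀ {n} s (w : List (Letter (suc n))) → smaller (s , zero) w ≡ 0
smaller-zero s []      = ≡.refl
smaller-zero s (y ∷ w) = smaller-zero s w

smaller-last : ∀ {m} s (w : List (Letter m)) → smaller (s , fromℕ m) (map emb w) ≡ length w
smaller-last     s []      = ≡.refl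
smaller-last {m} s (y ∷ w)
  rewrite <ᵇ-true (≡.subst₂ _<_ (≡.sym (absℕ-emb y)) (≡.sym (toℕ-fromℕ m)) (absℕ< y)) = cong suc (smaller-last s w)

-- Before rotation the exceptional letter, standing to the right of `x`, has the least absolute
-- value and is counted; afterwards it has the greatest and is not. No other comparison changes.
smaller-rotate : ∀ {m} s s′ (x : Letter m) a b →
  smaller (lift x) (map lift a ++ (s , zero) ∷ map lift b) ≡
  suc (smaller (emb x) (map emb a ++ (s′ , fromℕ m) ∷ map emb b))
smaller-rotate {m} s s′ x [] b
  rewrite <ᵇ-false (≡.subst₂ _≤_ (≡.sym (absℕ-emb x)) (≡.sym (toℕ-fromℕ m)) (ℕ.<⇒≤ (absℕ< x))) =
  cong suc (≡.trans (smaller-map lift (λ _ _ → ≡.refl) x b) (≡.sym (smaller-map emb emb-<ᵇ x b)))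
smaller-rotate s s′ x (y ∷ a) b rewrite emb-<ᵇ x y with absℕ y <ᵇ absℕ x
... | true  = cong suc (smaller-rotate s s′ x a b)
... | false = smaller-rotate s s′ x a b

-- The exceptional letter forms an inversion with every letter of `a` before rotation, and with
-- every letter of `b` after it. The difference of the two counts is stated additively to avoid
-- truncated subtraction.
inv-rotate : ∀ {m} s s′ (a b : List (Letter m)) →
  inv (map emb a ++ (s′ , fromℕ m) ∷ map emb b) ℕ.+ length a ≡
  inv (map lift a ++ (s , zero) ∷ map lift b) ℕ.+ length b
inv-rotate s s′ [] b
  rewrite smaller-last s′ b | smaller-zero s (map lift b)
        | inv-map emb emb-<ᵇ b | inv-map lift (λ _ _ → ≡.refl) b =
  ≡.trans (ℕ.+-identityʳ _) (ℕ.+-comm (length b) (inv b))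
inv-rotate {m} s s′ (x ∷ a) b rewrite smaller-rotate s s′ x a b = begin
  k ℕ.+ i ℕ.+ suc (length a)   ≡⟨ shuffle k i (length a) ⟩
  suc k ℕ.+ (i ℕ.+ length a)   ≡⟨ cong (suc k ℕ.+_) (inv-rotate s s′ a b) ⟩
  suc k ℕ.+ (i′ ℕ.+ length b)  ≡⟨ ℕ.+-assoc (suc k) i′ (length b) ⟨
  suc k ℕ.+ i′ ℕ.+ length b    ∎
  where
  open ≡.≡-Reasoning
  k = smaller (emb x) (map emb a ++ (s′ , fromℕ m) ∷ map emb b)
  i = inv (map emb a ++ (s′ , fromℕ m) ∷ map emb b)
  i′ = inv (map lift a ++ (s , zero) ∷ map lift b)
  shuffle : ∀ k i l → k ℕ.+ i ℕ.+ suc l ≡ suc k ℕ.+ (i ℕ.+ l)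
  shuffle = solve-∀

neg-map-cong : ∀ {m} (a : List (Letter m)) → neg (map emb a) ≡ neg (map lift a)
neg-map-cong []                = ≡.refl
neg-map-cong ((true , _) ∷ a)  = cong suc (neg-map-cong a)
neg-map-cong ((false , _) ∷ a) = neg-map-cong a

neg-rotate-true : ∀ {m} (a b : List (Letter m)) →
  neg (map lift a ++ (true , zero) ∷ map lift b) ≡ suc (neg (map emb a ++ (false , fromℕ m) ∷ map emb b))
neg-rotate-true []                b = cong suc (≡.sym (neg-map-cong b))
neg-rotate-true ((true , _) ∷ a)  b = cong suc (neg-rotate-true a b)
neg-rotate-true ((false , _) ∷ a) b = neg-rotate-true a b

neg-rotate-false : ∀ {m} (a b : List (Letter m)) →
  neg (map emb a ++ (true , fromℕ m) ∷ map emb b) ≡ suc (neg (map lift a ++ (false , zero) ∷ map lift b))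
neg-rotate-false []                b = cong suc (neg-map-cong b)
neg-rotate-false ((true , _) ∷ a)  b = cong suc (neg-rotate-false a b)
neg-rotate-false ((false , _) ∷ a) b = neg-rotate-false a b

-- `P` restricts the comparison to letters that occur in the word; it serves to exclude -1, where
-- `key` wraps around under `ρ`.
majFrom-map : ∀ {n n′} (f : Letter n → Letter n′) {P : Letter n → Set} →
  (∀ {x y} → P x → P y → (key (f y) <ᵇ key (f x)) ≡ (key y <ᵇ key x)) →
  ∀ pos {w} → All P w → majFrom pos (map f w) ≡ majFrom pos w
majFrom-map f f-<ᵇ pos []                 = ≡.refl
majFrom-map f f-<ᵇ pos (px ∷ [])          = ≡.refl
majFrom-map f f-<ᵇ pos (px ∷ py ∷ pw) =
  cong₂ (λ b k → (if b then pos else 0) ℕ.+ k) (f-<ᵇ px py) (majFrom-map f f-<ᵇ (suc pos) (py ∷ pw))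

majFrom-ρ : ∀ {m} pos {w : List (Letter (suc m))} → All (_≢ bottom) w → majFrom pos (map ρ w) ≡ majFrom pos w
majFrom-ρ = majFrom-map ρ λ {x} {y} x≢ y≢ → ≡.sym (cong₂ _<ᵇ_ (key-ρ y y≢) (key-ρ x x≢))

lift-≢bottom : ∀ {m} (a : List (Letter m)) → All (_≢ bottom) (map lift a)
lift-≢bottom []      = []
lift-≢bottom (x ∷ a) = (λ ()) ∷ lift-≢bottom a

majFrom-emb-lift : ∀ {m} pos (a : List (Letter m)) → majFrom pos (map emb a) ≡ majFrom pos (map lift a)
majFrom-emb-lift pos a = ≡.trans (cong (majFrom pos) (map-∘ a)) (majFrom-ρ pos (lift-≢bottom a))

lift-emb-<ᵇ : ∀ {m} (x y : Letter m) → (key (emb y) <ᵇ key (emb x)) ≡ (key (lift y) <ᵇ key (lift x))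
lift-emb-<ᵇ x y = ≡.sym (cong₂ _<ᵇ_ (key-lift y) (key-lift x))

-- The greatest letter descends to whatever follows it, the least letter never does; the rest of the
-- word has the same descents on both sides.
majFrom-top∷ : ∀ {m} pos y (b : List (Letter m)) →
  majFrom pos (top ∷ map emb (y ∷ b)) ≡ pos ℕ.+ majFrom pos (bottom ∷ map lift (y ∷ b))
majFrom-top∷ pos y b rewrite <ᵇ-true (key-emb<top y) = cong (pos ℕ.+_) (majFrom-emb-lift (suc pos) (y ∷ b))

-- The bottom letter creates a descent just before itself, the top letter just after.
majFrom-rotate : ∀ {m} pos (x : Letter m) a y b →
  majFrom pos (map emb (x ∷ a) ++ top ∷ map emb (y ∷ b)) ≡
  suc (majFrom pos (map lift (x ∷ a) ++ bottom ∷ map lift (y ∷ b)))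
majFrom-rotate pos x [] y b
  -- The descent moves from `pos` to `suc pos`. Rewriting by `key-lift x` exposes a successor, so
  -- that the comparison with the key 0 of `bottom` reduces to `true`.
  rewrite <ᵇ-false (ℕ.<⇒≤ (key-emb<top x)) | key-lift x | majFrom-top∷ (suc pos) y b = ≡.refl
majFrom-rotate pos x (x′ ∷ a) y b rewrite lift-emb-<ᵇ x x′ | majFrom-rotate (suc pos) x′ a y b = ℕ.+-suc _ _

maj-rotate : ∀ {m} (a : List (Letter m)) y b →
  maj (map emb a ++ top ∷ map emb (y ∷ b)) ≡ suc (maj (map lift a ++ bottom ∷ map lift (y ∷ b)))
-- With nothing in front no descent is lost, and the one gained is at position 1.
maj-rotate []      y b = majFrom-top∷ 1 y b
maj-rotate (x ∷ a) y b = majFrom-rotate 1 x a y b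

-- If the exceptional letter is 1, no descent changes and `neg` grows by 1. If it is -1, `maj` grows
-- by 1 and `neg` drops by 1, a net change of 2 - 1. The gain in `maj` needs a letter after -1,
-- which `x ≢ bottom` guarantees.
fmaj-ρ : ∀ {m} (a : List (Letter m)) s b u {x} → x ≢ bottom →
         map lift a ++ (s , zero) ∷ map lift b ≡ u ∷ʳ x →
         fmaj (map ρ (map lift a ++ (s , zero) ∷ map lift b)) ≡
         suc (fmaj (map lift a ++ (s , zero) ∷ map lift b))
fmaj-ρ a false b u _ _ = begin
  2 ℕ.* maj (map ρ w) ℕ.+ neg (map ρ w) ≡⟨ cong₂ (λ j k → 2 ℕ.* j ℕ.+ k) (majFrom-ρ 1 w≢bottom) neg-eq ⟩
  2 ℕ.* maj w ℕ.+ suc (neg w)           ≡⟨ ℕ.+-suc _ _ ⟩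
  suc (2 ℕ.* maj w ℕ.+ neg w)           ∎
  where
  open ≡.≡-Reasoning
  w = map lift a ++ (false , zero) ∷ map lift b
  w≢bottom : All (_≢ bottom) w
  w≢bottom = All.++⁺ (lift-≢bottom a) ((λ ()) ∷ lift-≢bottom b)
  neg-eq : neg (map ρ w) ≡ suc (neg w)
  neg-eq = ≡.trans (cong neg (map-ρ-decomposition a false b)) (neg-rotate-false a b)
fmaj-ρ a true [] u x≢bottom eq = ⊥-elim (x≢bottom (≡.sym (∷ʳ-injectiveʳ (map lift a) u eq)))
fmaj-ρ a true b@(y ∷ b′) u _ _ rewrite map-ρ-decomposition a true b = begin
  2 ℕ.* maj w′ ℕ.+ neg w′          ≡⟨ cong (λ k → 2 ℕ.* k ℕ.+ neg w′) (maj-rotate a y b′) ⟩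
  2 ℕ.* suc (maj w) ℕ.+ neg w′     ≡⟨ shuffle (maj w) (neg w′) ⟩
  suc (2 ℕ.* maj w ℕ.+ suc (neg w′)) ≡⟨ cong (λ k → suc (2 ℕ.* maj w ℕ.+ k)) (neg-rotate-true a b) ⟨
  suc (2 ℕ.* maj w ℕ.+ neg w)      ∎
  where
  open ≡.≡-Reasoning
  w  = map lift a ++ bottom ∷ map lift b
  w′ = map emb a ++ top ∷ map emb b
  shuffle : ∀ j k → 2 ℕ.* suc j ℕ.+ k ≡ suc (2 ℕ.* j ℕ.+ suc k)
  shuffle = solve-∀

-- Appending the top letter

distinctAbs-emb-∷ʳ : ∀ {m} (w : List (Letter m)) → distinctAbs (map emb w ∷ʳ top) ≡ distinctAbs w
distinctAbs-emb-∷ʳ {m} w = begin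
  distinct (map absℕ (map emb w ∷ʳ top))             ≡⟨ cong distinct (map-++ absℕ (map emb w) _) ⟩
  distinct (map absℕ (map emb w) ∷ʳ toℕ (fromℕ m))   ≡⟨ distinct-∷ʳ (All.map⁺ (All.map⁺ (All.universal abs≢ w))) ⟩
  distinct (map absℕ (map emb w))                    ≡⟨ distinctAbs-map emb (λ x y → cong₂ _≡ᵇ_ (absℕ-emb x) (absℕ-emb y)) w ⟩
  distinctAbs w                                      ∎
  where
  open ≡.≡-Reasoning
  abs≢ : ∀ x → (absℕ (emb x) ≡ᵇ toℕ (fromℕ m)) ≡ false
  abs≢ x rewrite absℕ-emb x | toℕ-fromℕ m = <⇒≡ᵇ-false (absℕ< x)

smaller-emb-∷ʳ : ∀ {m} (x : Letter m) w → smaller (emb x) (map emb w ∷ʳ top) ≡ smaller x w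
smaller-emb-∷ʳ {m} x []
  rewrite <ᵇ-false (≡.subst₂ _≤_ (≡.sym (absℕ-emb x)) (≡.sym (toℕ-fromℕ m)) (ℕ.<⇒≤ (absℕ< x))) = ≡.refl
smaller-emb-∷ʳ x (y ∷ w) rewrite emb-<ᵇ x y with absℕ y <ᵇ absℕ x
... | true  = cong suc (smaller-emb-∷ʳ x w)
... | false = smaller-emb-∷ʳ x w

inv-emb-∷ʳ : ∀ {m} (w : List (Letter m)) → inv (map emb w ∷ʳ top) ≡ inv w
inv-emb-∷ʳ []      = ≡.refl
inv-emb-∷ʳ (x ∷ w) = cong₂ ℕ._+_ (smaller-emb-∷ʳ x w) (inv-emb-∷ʳ w)

neg-emb-∷ʳ : ∀ {m} (w : List (Letter m)) → neg (map emb w ∷ʳ top) ≡ neg w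
neg-emb-∷ʳ []                = ≡.refl
neg-emb-∷ʳ ((true , _) ∷ w)  = cong suc (neg-emb-∷ʳ w)
neg-emb-∷ʳ ((false , _) ∷ w) = neg-emb-∷ʳ w

-- Enlarging the alphabet raises the keys of positive letters by one and fixes those of negative
-- letters. The order survives because every negative letter lies below every positive one.
key-emb-<ᵇ : ∀ {m} (x y : Letter m) → (key (emb y) <ᵇ key (emb x)) ≡ (key y <ᵇ key x)
key-emb-<ᵇ (true , i)  (true , j)  rewrite toℕ-inject₁ i | toℕ-inject₁ j = ≡.refl
key-emb-<ᵇ (false , i) (false , j) rewrite toℕ-inject₁ i | toℕ-inject₁ j = ≡.refl
key-emb-<ᵇ {m} (true , i) (false , j) rewrite toℕ-inject₁ i | toℕ-inject₁ j =
  ≡.trans (<ᵇ-false (ℕ.m≤n⇒m≤1+n i≤)) (≡.sym (<ᵇ-false i≤))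
  where
  i≤ : toℕ i ≤ m ℕ.+ toℕ j
  i≤ = ℕ.≤-trans (ℕ.<⇒≤ (toℕ<n i)) (ℕ.m≤m+n m _)
key-emb-<ᵇ {m} (false , i) (true , j) rewrite toℕ-inject₁ i | toℕ-inject₁ j =
  ≡.trans (<ᵇ-true (ℕ.m<n⇒m<1+n j<)) (≡.sym (<ᵇ-true j<))
  where
  j< : toℕ j < m ℕ.+ toℕ i
  j< = ℕ.<-≤-trans (toℕ<n j) (ℕ.m≤m+n m _)

-- The greatest letter, put at the end, creates no descent.
majFrom-emb-∷ʳ : ∀ {m} pos (w : List (Letter m)) → majFrom pos (map emb w ∷ʳ top) ≡ majFrom pos w
majFrom-emb-∷ʳ pos []          = ≡.refl
majFrom-emb-∷ʳ pos (x ∷ [])    rewrite <ᵇ-false (ℕ.<⇒≤ (key-emb<top x)) = ≡.refl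
majFrom-emb-∷ʳ pos (x ∷ y ∷ w) =
  cong₂ (λ b k → (if b then pos else 0) ℕ.+ k) (key-emb-<ᵇ x y) (majFrom-emb-∷ʳ (suc pos) (y ∷ w))

fmaj-emb-∷ʳ : ∀ {m} (w : List (Letter m)) → fmaj (map emb w ∷ʳ top) ≡ fmaj w
fmaj-emb-∷ʳ w = cong₂ (λ j k → 2 ℕ.* j ℕ.+ k) (majFrom-emb-∷ʳ 1 w) (neg-emb-∷ʳ w)

distinctAbs-last-∷ʳ : ∀ {m} (u : List (Letter (suc m))) s v → distinctAbs ((u ++ (s , fromℕ m) ∷ v) ∷ʳ top) ≡ false
distinctAbs-last-∷ʳ {m} u s v = begin
  distinct (map absℕ ((u ++ (s , fromℕ m) ∷ v) ∷ʳ top))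
    ≡⟨ cong distinct (map-++ absℕ (u ++ (s , fromℕ m) ∷ v) _) ⟩
  distinct (map absℕ (u ++ (s , fromℕ m) ∷ v) ∷ʳ c)
    ≡⟨ cong (λ l → distinct (l ∷ʳ c)) (map-++ absℕ u _) ⟩
  distinct ((map absℕ u ++ c ∷ map absℕ v) ∷ʳ c)
    ≡⟨ cong distinct (++-assoc (map absℕ u) _ _) ⟩
  distinct (map absℕ u ++ c ∷ map absℕ v ∷ʳ c)
    ≡⟨ distinct-repeat c (map absℕ u) (map absℕ v) [] ⟩
  false ∎
  where
  open ≡.≡-Reasoning
  c = toℕ (fromℕ m)

module _ {c ℓ} (R : CommutativeRing c ℓ) where
  open CommutativeRing R hiding (zero)
  open RingDefs R
  open RingProperties ring using (-‿distribˡ-*; -‿involutive)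
  open SetoidReasoning setoid
  module Solver = SemiringSolver commutativeSemiring

  -- Finite sums

  ∑ : {A : Set} → List A → (A → Carrier) → Carrier
  ∑ xs g = sumL (map g xs)

  ∑-cong : ∀ {A : Set} (xs : List A) {g h : A → Carrier} → (∀ x → g x ≈ h x) → ∑ xs g ≈ ∑ xs h
  ∑-cong []       g≈h = refl
  ∑-cong (x ∷ xs) g≈h = +-cong (g≈h x) (∑-cong xs g≈h)

  ∑-zero : ∀ {A : Set} (xs : List A) {g : A → Carrier} → (∀ x → g x ≈ 0#) → ∑ xs g ≈ 0#
  ∑-zero []       g≈0 = refl
  ∑-zero (x ∷ xs) g≈0 = trans (+-cong (g≈0 x) (∑-zero xs g≈0)) (+-identityˡ 0#)

  ∑-+ : ∀ {A : Set} (xs : List A) (g h : A → Carrier) → ∑ xs (λ x → g x + h x) ≈ ∑ xs g + ∑ xs h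
  ∑-+ []       g h = sym (+-identityˡ 0#)
  ∑-+ (x ∷ xs) g h = trans (+-congˡ (∑-+ xs g h))
    (solve 4 (λ a b c d → (a :+ b) :+ (c :+ d) := (a :+ c) :+ (b :+ d)) refl (g x) (h x) (∑ xs g) (∑ xs h))
    where open Solver

  ∑-distribˡ : ∀ {A : Set} p (xs : List A) (g : A → Carrier) → ∑ xs (λ x → p * g x) ≈ p * ∑ xs g
  ∑-distribˡ p []       g = sym (zeroʳ p)
  ∑-distribˡ p (x ∷ xs) g = trans (+-congˡ (∑-distribˡ p xs g)) (sym (distribˡ p (g x) (∑ xs g)))

  ∑-swap : ∀ {A B : Set} (xs : List A) (ys : List B) (g : A → B → Carrier) →
           ∑ xs (λ x → ∑ ys (g x)) ≈ ∑ ys (λ y → ∑ xs (λ x → g x y))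
  ∑-swap []       ys g = sym (∑-zero ys (λ _ → refl))
  ∑-swap (x ∷ xs) ys g = trans (+-congˡ (∑-swap xs ys g)) (sym (∑-+ ys (g x) _))

  ∑-++ : ∀ {A : Set} (xs ys : List A) (g : A → Carrier) → ∑ (xs ++ ys) g ≈ ∑ xs g + ∑ ys g
  ∑-++ []       ys g = sym (+-identityˡ _)
  ∑-++ (x ∷ xs) ys g = trans (+-congˡ (∑-++ xs ys g)) (sym (+-assoc _ _ _))

  ∑-map : ∀ {A B : Set} (f : A → B) xs (g : B → Carrier) → ∑ (map f xs) g ≡ ∑ xs (g ∘ f)
  ∑-map f xs g = cong sumL (≡.sym (map-∘ xs))

  ∑-concatMap : ∀ {A B : Set} (f : A → List B) xs (g : B → Carrier) →
                ∑ (concatMap f xs) g ≈ ∑ xs (λ x → ∑ (f x) g)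
  ∑-concatMap f []       g = refl
  ∑-concatMap f (x ∷ xs) g = trans (∑-++ (f x) (concatMap f xs) g) (+-congˡ (∑-concatMap f xs g))

  ∑-filterᵇ : ∀ {A : Set} (p : A → Bool) xs (g : A → Carrier) →
              ∑ (filterᵇ p xs) g ≈ ∑ xs (λ x → if p x then g x else 0#)
  ∑-filterᵇ p []       g = refl
  ∑-filterᵇ p (x ∷ xs) g with p x
  ... | true  = +-congˡ (∑-filterᵇ p xs g)
  ... | false = trans (∑-filterᵇ p xs g) (sym (+-identityˡ _))

  ∑Fin : ∀ {n} → (Fin n → Carrier) → Carrier
  ∑Fin h = sumL (tabulate h)

  ∑Fin-cong : ∀ {n} {g h : Fin n → Carrier} → (∀ i → g i ≈ h i) → ∑Fin g ≈ ∑Fin h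
  ∑Fin-cong {zero}  g≈h = refl
  ∑Fin-cong {suc n} g≈h = +-cong (g≈h zero) (∑Fin-cong (g≈h ∘ suc))

  ∑Fin-init-last : ∀ {n} (h : Fin (suc n) → Carrier) → ∑Fin h ≈ ∑Fin (h ∘ inject₁) + h (fromℕ n)
  ∑Fin-init-last {zero}  h = +-comm _ _
  ∑Fin-init-last {suc n} h = trans (+-congˡ (∑Fin-init-last (h ∘ suc))) (sym (+-assoc _ _ _))

  -- Sums over letters and words

  ∑-letters : ∀ n (g : Letter n → Carrier) →
              ∑ (letters n) g ≈ ∑Fin (λ i → g (true , i)) + ∑Fin (λ i → g (false , i))
  ∑-letters n g = begin
    ∑ (letters n) g
      ≈⟨ ∑-concatMap (λ b → map (b ,_) (allFin n)) (true ∷ false ∷ []) g ⟩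
    ∑ (map (true ,_) (allFin n)) g + (∑ (map (false ,_) (allFin n)) g + 0#)
      ≈⟨ +-cong (half true) (trans (+-identityʳ _) (half false)) ⟩
    ∑Fin (λ i → g (true , i)) + ∑Fin (λ i → g (false , i)) ∎
    where
    half : ∀ s → ∑ (map (s ,_) (allFin n)) g ≈ ∑Fin (λ i → g (s , i))
    half s = reflexive (≡.trans (∑-map (s ,_) (allFin n) g) (cong sumL (map-tabulate {n = n} (λ i → i) (λ i → g (s , i)))))

  -- `ρ` permutes the alphabet: it shifts each sign class down and sends the first letter of each
  -- class to the end of the other. Only the grouping of terms changes.
  ∑-letters-ρ : ∀ {m} (g : Letter (suc m) → Carrier) → ∑ (letters (suc m)) (g ∘ ρ) ≈ ∑ (letters (suc m)) g
  ∑-letters-ρ {m} g = begin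
    ∑ (letters (suc m)) (g ∘ ρ)  ≈⟨ ∑-letters (suc m) (g ∘ ρ) ⟩
    (g (false , fromℕ m) + init true) + (g (true , fromℕ m) + init false)
      ≈⟨ solve 4 (λ a b c d → (a :+ b) :+ (c :+ d) := (b :+ c) :+ (d :+ a)) refl
           (g (false , fromℕ m)) (init true) (g (true , fromℕ m)) (init false) ⟩
    (init true + g (true , fromℕ m)) + (init false + g (false , fromℕ m))
      ≈⟨ +-cong (∑Fin-init-last (λ i → g (true , i))) (∑Fin-init-last (λ i → g (false , i))) ⟨
    ∑Fin (λ i → g (true , i)) + ∑Fin (λ i → g (false , i)) ≈⟨ ∑-letters (suc m) g ⟨
    ∑ (letters (suc m)) g        ∎
    where
    open Solver
    init : Bool → Carrier
    init s = ∑Fin (λ i → g (s , inject₁ i))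

  ∑-letters-emb : ∀ {m} (g : Letter (suc m) → Carrier) → (∀ s → g (s , fromℕ m) ≈ 0#) →
                  ∑ (letters (suc m)) g ≈ ∑ (letters m) (g ∘ emb)
  ∑-letters-emb {m} g g-last≈0 = begin
    ∑ (letters (suc m)) g                                  ≈⟨ ∑-letters (suc m) g ⟩
    ∑Fin (λ i → g (true , i)) + ∑Fin (λ i → g (false , i)) ≈⟨ +-cong (half true) (half false) ⟩
    ∑Fin (λ i → g (true , inject₁ i)) + ∑Fin (λ i → g (false , inject₁ i)) ≈⟨ ∑-letters m (g ∘ emb) ⟨
    ∑ (letters m) (g ∘ emb)                                ∎
    where
    half : ∀ s → ∑Fin (λ i → g (s , i)) ≈ ∑Fin (λ i → g (s , inject₁ i))
    half s = trans (∑Fin-init-last (λ i → g (s , i))) (trans (+-congˡ (g-last≈0 s)) (+-identityʳ _))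

  module _ {A : Set} (xs : List A) where

    ∑-words-suc : ∀ k (g : List A → Carrier) →
                  ∑ (words xs (suc k)) g ≈ ∑ xs (λ x → ∑ (words xs k) (g ∘ (x ∷_)))
    ∑-words-suc k g = trans (∑-concatMap (λ x → map (x ∷_) (words xs k)) xs g)
      (∑-cong xs (λ x → reflexive (∑-map (x ∷_) (words xs k) g)))

    -- The length is made available to the pointwise hypothesis because the effect of `ρ` on the
    -- sign depends on it.
    ∑-words-cong : ∀ k {g h : List A → Carrier} → (∀ w → length w ≡ k → g w ≈ h w) →
                   ∑ (words xs k) g ≈ ∑ (words xs k) h
    ∑-words-cong zero    g≈h = +-congʳ (g≈h [] ≡.refl)
    ∑-words-cong (suc k) {g} {h} g≈h = begin
      ∑ (words xs (suc k)) g                       ≈⟨ ∑-words-suc k g ⟩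
      ∑ xs (λ x → ∑ (words xs k) (g ∘ (x ∷_)))     ≈⟨ ∑-cong xs (λ x → ∑-words-cong k λ w |w|≡k → g≈h (x ∷ w) (cong suc |w|≡k)) ⟩
      ∑ xs (λ x → ∑ (words xs k) (h ∘ (x ∷_)))     ≈⟨ ∑-words-suc k h ⟨
      ∑ (words xs (suc k)) h                       ∎

    -- `words` branches on the first letter, whereas the recursion in n classifies words by their
    -- last letter.
    ∑-words-∷ʳ : ∀ k (g : List A → Carrier) →
                 ∑ (words xs (suc k)) g ≈ ∑ xs (λ x → ∑ (words xs k) (λ w → g (w ∷ʳ x)))
    ∑-words-∷ʳ zero    g = ∑-words-suc zero g
    ∑-words-∷ʳ (suc k) g = begin
      ∑ (words xs (suc (suc k))) g
        ≈⟨ ∑-words-suc (suc k) g ⟩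
      ∑ xs (λ y → ∑ (words xs (suc k)) (g ∘ (y ∷_)))
        ≈⟨ ∑-cong xs (λ y → ∑-words-∷ʳ k (g ∘ (y ∷_))) ⟩
      ∑ xs (λ y → ∑ xs (λ x → ∑ (words xs k) (λ w → g (y ∷ w ∷ʳ x))))
        ≈⟨ ∑-swap xs xs _ ⟩
      ∑ xs (λ x → ∑ xs (λ y → ∑ (words xs k) (λ w → g (y ∷ w ∷ʳ x))))
        ≈⟨ ∑-cong xs (λ x → ∑-words-suc k (λ w → g (w ∷ʳ x))) ⟨
      ∑ xs (λ x → ∑ (words xs (suc k)) (λ w → g (w ∷ʳ x))) ∎

  -- Rotation is a bijection on all words, letter by letter, so the sum can be reindexed without
  -- building a bijection of `Bn`.
  ∑-words-ρ : ∀ {m} k (g : List (Letter (suc m)) → Carrier) →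
              ∑ (words (letters (suc m)) k) (g ∘ map ρ) ≈ ∑ (words (letters (suc m)) k) g
  ∑-words-ρ zero    g = refl
  ∑-words-ρ {m} (suc k) g = begin
    ∑ (words L (suc k)) (g ∘ map ρ)                      ≈⟨ ∑-words-suc L k (g ∘ map ρ) ⟩
    ∑ L (λ x → ∑ (words L k) (λ w → g (ρ x ∷ map ρ w)))  ≈⟨ ∑-cong L (λ x → ∑-words-ρ k (g ∘ (ρ x ∷_))) ⟩
    ∑ L (λ x → ∑ (words L k) (λ w → g (ρ x ∷ w)))        ≈⟨ ∑-letters-ρ (λ x → ∑ (words L k) (g ∘ (x ∷_))) ⟩
    ∑ L (λ x → ∑ (words L k) (λ w → g (x ∷ w)))          ≈⟨ ∑-words-suc L k g ⟨
    ∑ (words L (suc k)) g                                ∎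
    where L = letters (suc m)

  ∑-words-emb : ∀ {m} k (g : List (Letter (suc m)) → Carrier) → (∀ u s v → g (u ++ (s , fromℕ m) ∷ v) ≈ 0#) →
                ∑ (words (letters (suc m)) k) g ≈ ∑ (words (letters m) k) (g ∘ map emb)
  ∑-words-emb zero    g g≈0 = refl
  ∑-words-emb {m} (suc k) g g≈0 = begin
    ∑ (words L (suc k)) g
      ≈⟨ ∑-words-suc L k g ⟩
    ∑ L (λ x → ∑ (words L k) (g ∘ (x ∷_)))
      ≈⟨ ∑-letters-emb (λ x → ∑ (words L k) (g ∘ (x ∷_))) (λ s → ∑-zero (words L k) (g≈0 [] s)) ⟩
    ∑ L′ (λ x → ∑ (words L k) (g ∘ (emb x ∷_)))
      ≈⟨ ∑-cong L′ (λ x → ∑-words-emb k (g ∘ (emb x ∷_)) (λ u → g≈0 (emb x ∷ u))) ⟩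
    ∑ L′ (λ x → ∑ (words L′ k) (λ w → g (emb x ∷ map emb w)))
      ≈⟨ ∑-words-suc L′ k (g ∘ map emb) ⟨
    ∑ (words L′ (suc k)) (g ∘ map emb) ∎
    where
    L = letters (suc m)
    L′ = letters m

  -- Signs and q-integers

  -- `signAbs w` is `sgn (inv w)` by definition.
  sgn : ℕ → Carrier
  sgn k = if even k then 1# else - 1#

  sgn-suc : ∀ k → sgn (suc k) ≈ - sgn k
  sgn-suc k with even k
  ... | true  = refl
  ... | false = sym (-‿involutive 1#)

  sgn-+ : ∀ j k → sgn (j ℕ.+ k) ≈ sgn j * sgn k
  sgn-+ zero    k = sym (*-identityˡ _)
  sgn-+ (suc j) k = begin
    sgn (suc (j ℕ.+ k)) ≈⟨ sgn-suc (j ℕ.+ k) ⟩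
    - sgn (j ℕ.+ k)     ≈⟨ -‿cong (sgn-+ j k) ⟩
    - (sgn j * sgn k)   ≈⟨ -‿distribˡ-* (sgn j) (sgn k) ⟩
    - sgn j * sgn k     ≈⟨ *-congʳ (sgn-suc j) ⟨
    sgn (suc j) * sgn k ∎

  sgn-square : ∀ k → sgn k * sgn k ≈ 1#
  sgn-square k with even k
  ... | true  = *-identityˡ 1#
  ... | false = trans (sym (-‿distribˡ-* 1# (- 1#))) (trans (-‿cong (*-identityˡ _)) (-‿involutive 1#))

  -- Moving `a` across the equation costs the factor `sgn a`, which is its own inverse. This turns
  -- `inv-rotate` into a statement about signs.
  sgn-transfer : ∀ i j a b → i ℕ.+ a ≡ j ℕ.+ b → sgn i ≈ sgn (a ℕ.+ b) * sgn j
  sgn-transfer i j a b eq = begin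
    sgn i                        ≈⟨ *-identityʳ _ ⟨
    sgn i * 1#                   ≈⟨ *-congˡ (sgn-square a) ⟨
    sgn i * (sgn a * sgn a)      ≈⟨ *-assoc _ _ _ ⟨
    (sgn i * sgn a) * sgn a      ≈⟨ *-congʳ (trans (sym (sgn-+ i a)) (trans (reflexive (cong sgn eq)) (sgn-+ j b))) ⟩
    (sgn j * sgn b) * sgn a      ≈⟨ solve 3 (λ j b a → (j :* b) :* a := (a :* b) :* j) refl (sgn j) (sgn b) (sgn a) ⟩
    (sgn a * sgn b) * sgn j      ≈⟨ *-congʳ (sgn-+ a b) ⟨
    sgn (a ℕ.+ b) * sgn j        ∎
    where open Solver

  altq-suc : ∀ m q → altq (suc m) q ≈ sgn m * q
  altq-suc m q with even m
  ... | true  = sym (*-identityˡ q)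
  ... | false = trans (-‿cong (sym (*-identityˡ q))) (-‿distribˡ-* 1# q)

  qint-suc : ∀ k p → qint (suc k) p ≈ 1# + p * qint k p
  qint-suc k p = +-congˡ (begin
    sumL (map (pow p) (applyUpTo suc k))   ≈⟨ reflexive (cong (sumL ∘ map (pow p)) (≡.sym (map-upTo suc k))) ⟩
    ∑ (map suc (upTo k)) (pow p)           ≈⟨ reflexive (∑-map suc (upTo k) (pow p)) ⟩
    ∑ (upTo k) (λ i → p * pow p i)         ≈⟨ ∑-distribˡ p (upTo k) (pow p) ⟩
    p * qint k p                           ∎)

  qint-+ : ∀ j k p → qint (j ℕ.+ k) p ≈ qint j p + pow p j * qint k p
  qint-+ zero    k p = sym (trans (+-identityˡ _) (*-identityˡ _))
  qint-+ (suc j) k p = begin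
    qint (suc (j ℕ.+ k)) p                          ≈⟨ qint-suc (j ℕ.+ k) p ⟩
    1# + p * qint (j ℕ.+ k) p                       ≈⟨ +-congˡ (*-congˡ (qint-+ j k p)) ⟩
    1# + p * (qint j p + pow p j * qint k p)
      ≈⟨ solve 4 (λ p a b c → con 1 :+ p :* (a :+ b :* c) := (con 1 :+ p :* a) :+ (p :* b) :* c) refl
           p (qint j p) (pow p j) (qint k p) ⟩
    (1# + p * qint j p) + (p * pow p j) * qint k p  ≈⟨ +-congʳ (qint-suc j p) ⟨
    qint (suc j) p + pow p (suc j) * qint k p       ∎
    where open Solver

  -- `ρ` lowers indices, so each value is `p` times the next one and everything is expressed through
  -- the last.
  geometric-first : ∀ {m} p (h : Fin (suc m) → Carrier) → (∀ i → h (inject₁ i) ≈ p * h (suc i)) →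
                    h zero ≈ pow p m * h (fromℕ m)
  geometric-first {zero}  p h step = sym (*-identityˡ _)
  geometric-first {suc m} p h step =
    trans (step zero) (trans (*-congˡ (geometric-first p (h ∘ suc) (step ∘ suc))) (sym (*-assoc _ _ _)))

  geometric-sum : ∀ {m} p (h : Fin (suc m) → Carrier) → (∀ i → h (inject₁ i) ≈ p * h (suc i)) →
                  ∑Fin h ≈ qint (suc m) p * h (fromℕ m)
  geometric-sum {zero}  p h step = solve 1 (λ a → a :+ con 0 := (con 1 :+ con 0) :* a) refl (h zero)
    where open Solver
  geometric-sum {suc m} p h step = begin
    h zero + ∑Fin (h ∘ suc)
      ≈⟨ +-cong (geometric-first p h step) (geometric-sum p (h ∘ suc) (step ∘ suc)) ⟩
    pow p (suc m) * z + qint (suc m) p * z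
      -- `con 1 :+ con 0` is the unfolded `qint 1 p`, which prepares `qint-+`.
      ≈⟨ solve 3 (λ a b z → a :* z :+ b :* z := (b :+ a :* ((con 1 :+ con 0))) :* z) refl (pow p (suc m)) (qint (suc m) p) z ⟩
    (qint (suc m) p + pow p (suc m) * qint 1 p) * z
      ≈⟨ *-congʳ (qint-+ (suc m) 1 p) ⟨
    qint (suc m ℕ.+ 1) p * z
      ≈⟨ *-congʳ (reflexive (cong (λ k → qint k p) (ℕ.+-comm (suc m) 1))) ⟩
    qint (suc (suc m)) p * z ∎
    where
    open Solver
    z = h (fromℕ (suc m))

  prodL-∷ʳ : ∀ xs y → prodL (xs ∷ʳ y) ≈ prodL xs * y
  prodL-∷ʳ []       y = *-comm y 1#
  prodL-∷ʳ (x ∷ xs) y = trans (*-congˡ (prodL-∷ʳ xs y)) (sym (*-assoc _ _ _))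

  -- The recursion in n.

  module _ (q : Carrier) where

    -- Extension by zero from signed permutations to all words, so that sums run over full word
    -- lists, on which `ρ` and `emb` act letter by letter.
    weight : ∀ {n} → List (Letter n) → Carrier
    weight w = if distinctAbs w then signAbs w * pow q (fmaj w) else 0#

    LHS-weight : ∀ n → LHS n q ≈ ∑ (words (letters n) n) weight
    LHS-weight n = ∑-filterᵇ distinctAbs (words (letters n) n) _

    -- `fmaj` grows by 1, giving `q`; the sign changes by that of a cycle of length m + 1, which is
    -- `sgn m`.
    weight-ρ : ∀ {m} u (x : Letter (suc m)) → x ≢ bottom → length u ≡ m →
               weight (map ρ (u ∷ʳ x)) ≈ altq (suc m) q * weight (u ∷ʳ x)
    weight-ρ {m} u x x≢bottom |u|≡m
      rewrite distinctAbs-map ρ ρ-≡ᵇ (u ∷ʳ x) with distinctAbs (u ∷ʳ x) in distinct-ux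
    ... | false = sym (zeroʳ _)
    ... | true  = go (u ∷ʳ x) ≡.refl (decompose (u ∷ʳ x) distinct-ux)
      where
      |ux|≡1+m : length (u ∷ʳ x) ≡ suc m
      |ux|≡1+m = ≡.trans (length-++ u) (≡.trans (ℕ.+-comm (length u) 1) (cong suc |u|≡m))

      -- The word becomes a variable with an equation, since matching on `Decomposition` requires
      -- its index to be unifiable with the constructor forms.
      go : ∀ w → w ≡ u ∷ʳ x → Decomposition w →
           signAbs (map ρ w) * pow q (fmaj (map ρ w)) ≈ altq (suc m) q * (signAbs w * pow q (fmaj w))
      -- Without 1 or -1, there would be m + 1 distinct absolute values among only m.
      go w w≡ux (none a) = ⊥-elim (ℕ.<-irrefl ≡.refl (subst (_≤ m) |a|≡1+m (distinct⇒length≤ a distinct-a)))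
        where
        |a|≡1+m : length a ≡ suc m
        |a|≡1+m = ≡.trans (≡.sym (length-map lift a)) (≡.trans (cong length w≡ux) |ux|≡1+m)
        distinct-a : distinctAbs a ≡ true
        distinct-a = ≡.trans (≡.sym (distinctAbs-map lift (λ _ _ → ≡.refl) a)) (≡.trans (cong distinctAbs w≡ux) distinct-ux)
      go w w≡ux (one a s b) = begin
        sgn (inv (map ρ w)) * pow q (fmaj (map ρ w))
          ≈⟨ *-cong (sgn-transfer (inv (map ρ w)) (inv w) (length a) (length b) inv-eq)
                    (reflexive (cong (pow q) (fmaj-ρ a s b u x≢bottom w≡ux))) ⟩
        (sgn (length a ℕ.+ length b) * sgn (inv w)) * (q * pow q (fmaj w))
          ≈⟨ *-congʳ (*-congʳ (reflexive (cong sgn |a|+|b|≡m))) ⟩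
        (sgn m * sgn (inv w)) * (q * pow q (fmaj w))
          ≈⟨ solve 4 (λ e i q p → (e :* i) :* (q :* p) := (e :* q) :* (i :* p)) refl (sgn m) (sgn (inv w)) q (pow q (fmaj w)) ⟩
        (sgn m * q) * (sgn (inv w) * pow q (fmaj w))
          ≈⟨ *-congʳ (altq-suc m q) ⟨
        altq (suc m) q * (sgn (inv w) * pow q (fmaj w)) ∎
        where
        open Solver
        inv-eq : inv (map ρ w) ℕ.+ length a ≡ inv w ℕ.+ length b
        inv-eq = ≡.trans (cong (λ v → inv v ℕ.+ length a) (map-ρ-decomposition a s b)) (inv-rotate s (not s) a b)
        |a|+|b|≡m : length a ℕ.+ length b ≡ m
        |a|+|b|≡m = ℕ.suc-injective (≡.trans (≡.sym (ℕ.+-suc (length a) (length b)))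
          (≡.trans (≡.sym (≡.trans (length-++ (map lift a))
            (cong₂ (λ j k → j ℕ.+ suc k) (length-map lift a) (length-map lift b))))
          (≡.trans (cong length w≡ux) |ux|≡1+m)))

    weight-emb-∷ʳ : ∀ {m} (w : List (Letter m)) → weight (map emb w ∷ʳ top) ≡ weight w
    weight-emb-∷ʳ w rewrite distinctAbs-emb-∷ʳ w | inv-emb-∷ʳ w | fmaj-emb-∷ʳ w = ≡.refl

    weight-last-∷ʳ : ∀ {m} (u : List (Letter (suc m))) s v → weight ((u ++ (s , fromℕ m) ∷ v) ∷ʳ top) ≡ 0#
    weight-last-∷ʳ u s v rewrite distinctAbs-last-∷ʳ u s v = ≡.refl

    module _ (m : ℕ) where

      endingIn : Letter (suc m) → Carrier
      endingIn x = ∑ (words (letters (suc m)) m) (λ w → weight (w ∷ʳ x))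

      -- Reindexing the first m letters by `ρ` makes the whole word a rotated one, to which
      -- `weight-ρ` applies.
      endingIn-ρ : ∀ x → x ≢ bottom → endingIn (ρ x) ≈ altq (suc m) q * endingIn x
      endingIn-ρ x x≢bottom = begin
        ∑ W (λ w → weight (w ∷ʳ ρ x))
          ≈⟨ ∑-words-ρ m (λ w → weight (w ∷ʳ ρ x)) ⟨
        ∑ W (λ w → weight (map ρ w ∷ʳ ρ x))
          ≈⟨ ∑-words-cong (letters (suc m)) m (λ w |w|≡m →
               trans (reflexive (cong weight (≡.sym (map-++ ρ w _)))) (weight-ρ w x x≢bottom |w|≡m)) ⟩
        ∑ W (λ w → altq (suc m) q * weight (w ∷ʳ x))
          ≈⟨ ∑-distribˡ (altq (suc m) q) W _ ⟩
        altq (suc m) q * endingIn x ∎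
        where W = words (letters (suc m)) m

      -- Words with a second letter of largest absolute value have weight zero; the others arise by
      -- appending `top` to words over the smaller alphabet, which preserves the weight.
      endingIn-top : endingIn top ≈ LHS m q
      endingIn-top = begin
        endingIn top
          ≈⟨ ∑-words-emb m (λ w → weight (w ∷ʳ top)) (λ u s v → reflexive (weight-last-∷ʳ u s v)) ⟩
        ∑ (words (letters m) m) (λ w → weight (map emb w ∷ʳ top))
          ≈⟨ ∑-cong (words (letters m) m) (λ w → reflexive (weight-emb-∷ʳ w)) ⟩
        ∑ (words (letters m) m) weight
          ≈⟨ LHS-weight m ⟨
        LHS m q ∎

      LHS-suc : LHS (suc m) q ≈ LHS m q * qint (2 ℕ.* suc m) (altq (suc m) q)
      LHS-suc = begin
        LHS (suc m) q
          ≈⟨ LHS-weight (suc m) ⟩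
        ∑ (words (letters (suc m)) (suc m)) weight
          ≈⟨ ∑-words-∷ʳ (letters (suc m)) m weight ⟩
        ∑ (letters (suc m)) endingIn
          ≈⟨ ∑-letters (suc m) endingIn ⟩
        ∑Fin (λ i → endingIn (true , i)) + ∑Fin (λ i → endingIn (false , i))
          ≈⟨ +-cong (half true) (half false) ⟩
        k * endingIn (true , fromℕ m) + k * z
          -- The two halves are joined at `ρ` of 1, which is -n: the negative half is
          -- `pow p (suc m)` times the positive one.
          ≈⟨ +-congʳ (*-congˡ (trans (endingIn-ρ (false , zero) (λ ())) (*-congˡ
               (geometric-first p (λ i → endingIn (false , i)) (λ i → endingIn-ρ (false , suc i) (λ ())))))) ⟩
        k * (p * (pow p m * z)) + k * z
          ≈⟨ solve 4 (λ k p r z → k :* (p :* (r :* z)) :+ k :* z := z :* (k :+ (p :* r) :* k)) refl k p (pow p m) z ⟩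
        z * (k + pow p (suc m) * k)
          ≈⟨ *-cong endingIn-top (sym (qint-+ (suc m) (suc m) p)) ⟩
        LHS m q * qint (suc m ℕ.+ suc m) p
          ≈⟨ *-congˡ (reflexive (cong (λ j → qint (suc m ℕ.+ j) p) (≡.sym (ℕ.+-identityʳ (suc m))))) ⟩
        LHS m q * qint (2 ℕ.* suc m) p ∎
        where
        open Solver
        p = altq (suc m) q
        k = qint (suc m) p
        z = endingIn top
        half : ∀ s → ∑Fin (λ i → endingIn (s , i)) ≈ k * endingIn (s , fromℕ m)
        half s = geometric-sum p (λ i → endingIn (s , i)) (λ i → endingIn-ρ (s , suc i) (λ ()))

    RHS-suc : ∀ m → RHS (suc m) q ≈ RHS m q * qint (2 ℕ.* suc m) (altq (suc m) q)
    RHS-suc m = begin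
      prodL (map f (upTo (suc m)))  ≈⟨ reflexive (cong (prodL ∘ map f) (≡.sym (upTo-∷ʳ m))) ⟩
      prodL (map f (upTo m ∷ʳ m))   ≈⟨ reflexive (cong prodL (map-++ f (upTo m) _)) ⟩
      prodL (map f (upTo m) ∷ʳ f m) ≈⟨ prodL-∷ʳ (map f (upTo m)) (f m) ⟩
      RHS m q * f m                 ∎
      where
      f : ℕ → Carrier
      f j = qint (2 ℕ.* suc j) (altq (suc j) q)

    LHS≈RHS : ∀ n → LHS n q ≈ RHS n q
    -- The induction starts at 0, where the empty word has weight 1 and the product is empty.
    LHS≈RHS zero    = trans (+-identityʳ _) (*-identityˡ 1#)
    LHS≈RHS (suc m) = trans (LHS-suc m) (trans (*-congʳ (LHS≈RHS m)) (sym (RHS-suc m)))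

theorem6p2 : ∀ {c ℓ} (R : CommutativeRing c ℓ) (n : ℕ) → 1 ≤ n →
    (q : CommutativeRing.Carrier R) →
    CommutativeRing._≈_ R (RingDefs.LHS R n q) (RingDefs.RHS R n q)
theorem6p2 R n _ q = LHS≈RHS R q n
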